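{- For every $k\geq2$ there is a graph $G$ such that $\mathrm{stw}(G)+1\leq k+1\leq\mathrm{ca}_f(G)$.
   Context: All graphs are finite and simple. A simple $k$-tree is a graph obtainable by starting with a $(k+1)$-clique and repeatedly adding a new vertex adjacent exactly to the vertices of some $k$-clique of the current graph, such that no two vertices are added onto the same $k$-clique; $\mathrm{stw}(G)$ is the minimum $k$ such that $G$ is a subgraph of some simple $k$-tree. A caterpillar is a tree whose non-leaf vertices form a path; a caterpillar forest is a disjoint union of caterpillars. The folded caterpillar arboricity $\mathrm{ca}_f(G)$ is the minimum, over all edge-surjective graph homomorphisms $\varphi$ from a caterpillar forest to $G$, of $\max_{v\in V(G)}|\varphi^{ -1}(v)|$. -}

module Defs where

open import Data.Nat using (ℕ; zero; suc; _+_; _≤_; _<_)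
open import Data.Fin using (Fin; toℕ) renaming (zero to fz; suc to fs)
open import Data.Fin.Properties using (_≟_)
open import Data.Bool using (Bool; true; false; if_then_else_)
open import Data.List using (List; map)
open import Data.Nat.ListAction using (sum)
open import Data.List.Relation.Unary.Any using (Any)
open import Data.Product using (Σ; ∃; ∃₂; _×_; _,_)
open import Data.Sum using (_⊎_; inj₁; inj₂)
open import Data.Empty using (⊥)
open import Relation.Nullary using (¬_)
open import Relation.Nullary.Decidable using (⌊_⌋)
open import Relation.Binary.PropositionalEquality using (_≡_; _≢_)
open import Function.Definitions using (Injective)
open import Function.Bundles using (_⇔_)

record Graph : Set where
  field
    n      : ℕ
    adj    : Fin n → Fin n → Bool
    sym    : ∀ u v → adj u v ≡ adj v u
    irrefl : ∀ v → adj v v ≡ false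
open Graph public

Subgraph : Graph → Graph → Set
Subgraph G H =
  Σ (Fin (n G) → Fin (n H)) λ φ →
    Injective _≡_ _≡_ φ ×
    (∀ u v → adj G u v ≡ true → adj H (φ u) (φ v) ≡ true)

-- Simple k-trees.  The vertices are labelled in order of construction:
-- vertices 0..k form the initial (k+1)-clique, and each later vertex v
-- is added adjacent exactly to a k-clique of earlier vertices (its
-- "back-neighbourhood", given by an injective f : Fin k → earlier
-- vertices); no two added vertices have the same back-neighbourhood.

IsSimpleKTree : ℕ → Graph → Set
IsSimpleKTree k H =
  (suc k ≤ n H) ×
  (∀ (u v : Fin (n H)) → toℕ u < suc k → toℕ v < suc k → u ≢ v →
     adj H u v ≡ true) ×
  (∀ (v : Fin (n H)) → suc k ≤ toℕ v →
     Σ (Fin k → Fin (n H)) λ f →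
       Injective _≡_ _≡_ f ×
       (∀ i → toℕ (f i) < toℕ v) ×
       (∀ i j → i ≢ j → adj H (f i) (f j) ≡ true) ×
       (∀ u → toℕ u < toℕ v → (adj H u v ≡ true ⇔ ∃ λ i → f i ≡ u))) ×
  (∀ (v w : Fin (n H)) → suc k ≤ toℕ v → suc k ≤ toℕ w → v ≢ w →
     ¬ (∀ u → ((toℕ u < toℕ v × adj H u v ≡ true) ⇔
               (toℕ u < toℕ w × adj H u w ≡ true))))

StwLe : Graph → ℕ → Set
StwLe G k = ∃ λ k' → k' ≤ k × ∃ λ H → IsSimpleKTree k' H × Subgraph G H

-- Caterpillars: a spine path s_0 … s_t (t ≥ 0) with legs i pendant
-- leaves attached to s_i.  (Every caterpillar, including K1 and K2, is of
-- this form up to isomorphism.)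

record Caterpillar : Set where
  field
    spineLen-1 : ℕ
    legs       : Fin (suc spineLen-1) → ℕ
open Caterpillar public

CatV : Caterpillar → Set
CatV c = Fin (suc (spineLen-1 c)) ⊎ Σ (Fin (suc (spineLen-1 c))) (λ i → Fin (legs c i))

CatAdj : (c : Caterpillar) → CatV c → CatV c → Set
CatAdj c (inj₁ i) (inj₁ j) = (toℕ j ≡ suc (toℕ i)) ⊎ (toℕ i ≡ suc (toℕ j))
CatAdj c (inj₁ i) (inj₂ (j , _)) = i ≡ j
CatAdj c (inj₂ (j , _)) (inj₁ i) = j ≡ i
CatAdj c (inj₂ _) (inj₂ _) = ⊥

record CatHom (G : Graph) : Set where
  field
    cat   : Caterpillar
    hom   : CatV cat → Fin (n G)
    pres  : ∀ x y → CatAdj cat x y → adj G (hom x) (hom y) ≡ true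
open CatHom public

ForestHom : Graph → Set
ForestHom G = List (CatHom G)

EdgeSurjective : (G : Graph) → ForestHom G → Set
EdgeSurjective G hs =
  ∀ u v → adj G u v ≡ true →
    Any (λ h → ∃₂ λ x y → CatAdj (cat h) x y × hom h x ≡ u × hom h y ≡ v) hs

countFin : (m : ℕ) → (Fin m → Bool) → ℕ
countFin zero    p = 0
countFin (suc m) p = (if p fz then 1 else 0) + countFin m (λ i → p (fs i))

sumFin : (m : ℕ) → (Fin m → ℕ) → ℕ
sumFin zero    f = 0
sumFin (suc m) f = f fz + sumFin m (λ i → f (fs i))

catFiber : {G : Graph} → CatHom G → Fin (n G) → ℕ
catFiber h v =
  countFin (suc (spineLen-1 (cat h))) (λ i → ⌊ hom h (inj₁ i) ≟ v ⌋) +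
  sumFin (suc (spineLen-1 (cat h)))
    (λ i → countFin (legs (cat h) i) (λ j → ⌊ hom h (inj₂ (i , j)) ≟ v ⌋))

fiber : {G : Graph} → ForestHom G → Fin (n G) → ℕ
fiber hs v = sum (map (λ h → catFiber h v) hs)

CafGe : Graph → ℕ → Set
CafGe G m = ∀ (hs : ForestHom G) → EdgeSurjective G hs → ∃ λ v → m ≤ fiber hs v

{-# OPTIONS --safe #-}
module Submission where

open import Defs hiding (sym)
open import Data.Bool using (true; false; _∨_)
open import Data.Bool.Properties using (∨-comm)
open import Data.Fin using (Fin; toℕ; fromℕ<) renaming (zero to fz; suc to fs)
import Data.Fin.Properties as Fin
open import Data.List using (List; []; _∷_; _++_; length; map; concat; concatMap; filter; tabulate)
open import Data.List.Membership.Propositional using (_∈_; find; lose)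
open import Data.List.Membership.Propositional.Properties
  using (∈-map⁺; ∈-++⁺ˡ; ∈-++⁺ʳ; ∈-concat⁺′; ∈-concatMap⁺; ∈-tabulate⁺; ∈-filter⁺)
open import Data.List.Membership.Setoid.Properties using (index-injective)
open import Data.List.Properties using (length-map; length-++; filter-++; filter-some; filter-none)
open import Data.List.Relation.Unary.All using (universal)
open import Data.Nat using (ℕ; zero; suc; _+_; _*_; _∸_; _⊔_; _⊓_; _≤_; _<_; _≤?_; _<?_; _≟_; z≤n; s≤s; s≤s⁻¹)
open import Data.Nat.Properties hiding (_≟_; _≤?_; _<?_)
open import Data.Product using (Σ; ∃; ∃₂; _×_; _,_; proj₁; proj₂)
open import Data.Sum using (_⊎_; inj₁; inj₂; [_,_]′; swap) renaming (map to map⊎)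
open import Function using (_∘_; id)
open import Function.Bundles using (_⇔_; mk⇔; Equivalence)
open import Function.Definitions using (Injective)
open import Relation.Binary using (tri<; tri≈; tri>)
open import Relation.Binary.PropositionalEquality hiding ([_])
open import Relation.Nullary using (¬_; Dec; yes; no; contradiction)
open import Relation.Nullary.Decidable using (⌊_⌋; _×-dec_; _⊎-dec_)
open import Relation.Unary using (Decidable)

-- Arcs of a caterpillar forest (see Arc) correspond to its vertices, so if every
-- fiber has size at most k, at most k m arcs start over the vertices 0 … m-1 of a
-- k-tree, while its k (m - k) or more back edges below m all need arcs inside.
-- Hence at most k² arcs leave the initial segment 0 … m-1. For m = n this bounds
-- the number of caterpillars by k²; for a proper core it bounds the number of times
-- that a spine leaves the core. The graph has a core (the k-th power of a path)
-- with more than 2 k² pairwise non-adjacent clusters, each an edge outside the core.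
-- The edge of a cluster has an end over a spine vertex, and a spine reaches a cluster
-- only by starting there or by leaving the core, so some fiber exceeds k.

private variable
  A : Set
  P Q R : A → Set

-- Counting in filtered lists

injective-∈⇒≤ : ∀ {N} {f : Fin N → A} {ys} → Injective _≡_ _≡_ f → (∀ i → f i ∈ ys) → N ≤ length ys
injective-∈⇒≤ f-inj f∈ = Fin.injective⇒≤ λ {i} {j} eq →
  f-inj (index-injective (setoid _) (f∈ i) (f∈ j) eq)

filter-∪-≤ : (P? : Decidable P) (Q? : Decidable Q) (R? : Decidable R) → (∀ x → R x → P x ⊎ Q x) →
  ∀ xs → length (filter R? xs) ≤ length (filter P? xs) + length (filter Q? xs)
filter-∪-≤ P? Q? R? R⊆ [] = z≤n
filter-∪-≤ P? Q? R? R⊆ (x ∷ xs) with filter-∪-≤ P? Q? R? R⊆ xs | R? x | P? x | Q? x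
... | ih | no _  | no _  | no _  = ih
... | ih | no _  | no _  | yes _ = ≤-trans ih (+-monoʳ-≤ _ (n≤1+n _))
... | ih | no _  | yes _ | no _  = m≤n⇒m≤1+n ih
... | ih | no _  | yes _ | yes _ = m≤n⇒m≤1+n (≤-trans ih (+-monoʳ-≤ _ (n≤1+n _)))
... | ih | yes r | no ¬p | no ¬q = contradiction (R⊆ x r) [ ¬p , ¬q ]′
... | ih | yes _ | no _  | yes _ = ≤-trans (s≤s ih) (≤-reflexive (sym (+-suc _ _)))
... | ih | yes _ | yes _ | no _  = s≤s ih
... | ih | yes _ | yes _ | yes _ = s≤s (≤-trans ih (+-monoʳ-≤ _ (n≤1+n _)))

filter-⊎-≤ : (P? : Decidable P) (Q? : Decidable Q) (R? : Decidable R) →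
  (∀ x → P x → R x) → (∀ x → Q x → R x) → (∀ x → P x → ¬ Q x) →
  ∀ xs → length (filter P? xs) + length (filter Q? xs) ≤ length (filter R? xs)
filter-⊎-≤ P? Q? R? P⊆ Q⊆ P∥Q [] = z≤n
filter-⊎-≤ P? Q? R? P⊆ Q⊆ P∥Q (x ∷ xs) with filter-⊎-≤ P? Q? R? P⊆ Q⊆ P∥Q xs | R? x | P? x | Q? x
... | ih | _     | yes p | yes q = contradiction q (P∥Q x p)
... | ih | no ¬r | yes p | no _  = contradiction (P⊆ x p) ¬r
... | ih | no ¬r | no _  | yes q = contradiction (Q⊆ x q) ¬r
... | ih | no _  | no _  | no _  = ih
... | ih | yes _ | no _  | no _  = m≤n⇒m≤1+n ih
... | ih | yes _ | yes _ | no _  = s≤s ih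
... | ih | yes _ | no _  | yes _ = ≤-trans (≤-reflexive (+-suc _ _)) (s≤s ih)

filter-tabulate-≤ : ∀ {t} (P? : Decidable P) {Q : Fin t → Set} (Q? : ∀ i → Dec (Q i)) (f : Fin t → A) →
  (∀ i → P (f i) → Q i) → length (filter P? (tabulate f)) ≤ countFin t (λ i → ⌊ Q? i ⌋)
filter-tabulate-≤ {t = zero}  P? Q? f P⇒Q = z≤n
filter-tabulate-≤ {t = suc t} P? Q? f P⇒Q
  with filter-tabulate-≤ P? (Q? ∘ fs) (f ∘ fs) (P⇒Q ∘ fs) | P? (f fz) | Q? fz
... | ih | no _  | no _  = ih
... | ih | no _  | yes _ = m≤n⇒m≤1+n ih
... | ih | yes p | no ¬q = contradiction (P⇒Q fz p) ¬q
... | ih | yes _ | yes _ = s≤s ih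

length-filter-++ : (P? : Decidable P) (xs ys : List A) →
  length (filter P? (xs ++ ys)) ≡ length (filter P? xs) + length (filter P? ys)
length-filter-++ P? xs ys = trans (cong length (filter-++ P? xs ys)) (length-++ (filter P? xs))

filter-concat-tabulate-≤ : ∀ {t} (P? : Decidable P) (f : Fin t → List A) {b : Fin t → ℕ} →
  (∀ i → length (filter P? (f i)) ≤ b i) → length (filter P? (concat (tabulate f))) ≤ sumFin t b
filter-concat-tabulate-≤ {t = zero}  P? f bound = z≤n
filter-concat-tabulate-≤ {t = suc t} P? f bound =
  ≤-trans (≤-reflexive (length-filter-++ P? (f fz) _))
          (+-mono-≤ (bound fz) (filter-concat-tabulate-≤ P? (f ∘ fs) (bound ∘ fs)))

-- Arcs, and how many of them leave an initial segment

-- An arc u → w records a forest vertex over u together with the label w of its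
-- successor: the next spine vertex for a spine vertex, the spine neighbour for a
-- leg, and an out-of-range label for the last vertex of a spine.
Arc : Set
Arc = ℕ × ℕ

-- An arc covering an edge from `v` back to an earlier vertex satisfies `Top v`, whichever way it
-- runs. The out-of-range label makes the last arc of a spine an exit from the whole vertex set.
From Top Exit : ℕ → Arc → Set
From v (u , w) = u ≡ v
Top v (u , w)  = u ⊔ w ≡ v
Exit m (u , w) = u < m × m ≤ w

from? : ∀ v → Decidable (From v)
from? v (u , w) = u ≟ v

top? : ∀ v → Decidable (Top v)
top? v (u , w) = u ⊔ w ≟ v

exit? : ∀ m → Decidable (Exit m)
exit? m (u , w) = (u <? m) ×-dec (m ≤? w)

module Exits (k : ℕ) (arcs : List Arc) where

  from : ℕ → List Arc
  from v = filter (from? v) arcs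

  topped : ℕ → List Arc
  topped v = filter (top? v) arcs

  fromBelow inside exits : ℕ → List Arc
  fromBelow m = filter (λ a → proj₁ a <? m) arcs
  inside m    = filter (λ a → proj₁ a ⊔ proj₂ a <? m) arcs
  exits m     = filter (exit? m) arcs

  fromBelow-≤ : ∀ m → (∀ v → v < m → length (from v) ≤ k) → length (fromBelow m) ≤ m * k
  fromBelow-≤ zero    _     = ≤-reflexive (cong length (filter-none (λ a → proj₁ a <? 0) (universal (λ _ ()) arcs)))
  fromBelow-≤ (suc m) bound = begin
    length (fromBelow (suc m))
      ≤⟨ filter-∪-≤ (from? m) (λ a → proj₁ a <? m) (λ a → proj₁ a <? suc m)
           (λ _ u<1+m → swap (m<1+n⇒m<n∨m≡n u<1+m)) arcs ⟩
    length (from m) + length (fromBelow m)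
      ≤⟨ +-mono-≤ (bound m ≤-refl) (fromBelow-≤ m (λ v → bound v ∘ m<n⇒m<1+n)) ⟩
    k + m * k ∎
    where open ≤-Reasoning

  -- Each `v` with `k ≤ v < m` is the larger label of `k` arcs, all of them inside, and no arc is
  -- counted for two such `v`. The summand `k * k` compensates for the first `k` vertices, about
  -- which nothing is assumed.
  inside-≥ : ∀ m → (∀ v → k ≤ v → v < m → k ≤ length (topped v)) → m * k ≤ length (inside m) + k * k
  inside-≥ zero    _     = z≤n
  inside-≥ (suc m) bound with k ≤? m
  ... | no k≰m = ≤-trans (*-monoˡ-≤ k (≰⇒> k≰m)) (m≤n+m _ _)
  ... | yes k≤m = begin
    k + m * k
      ≤⟨ +-mono-≤ (bound m k≤m ≤-refl) (inside-≥ m (λ v k≤v → bound v k≤v ∘ m<n⇒m<1+n)) ⟩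
    length (topped m) + (length (inside m) + k * k)
      ≡⟨ +-assoc (length (topped m)) _ _ ⟨
    length (topped m) + length (inside m) + k * k
      ≤⟨ +-monoˡ-≤ (k * k) (filter-⊎-≤ (top? m) (λ a → proj₁ a ⊔ proj₂ a <? m)
           (λ a → proj₁ a ⊔ proj₂ a <? suc m) (λ _ → s≤s ∘ ≤-reflexive) (λ _ → m<n⇒m<1+n)
           (λ _ eq → <-irrefl eq) arcs) ⟩
    length (inside (suc m)) + k * k ∎
    where open ≤-Reasoning

  -- Inside arcs and exits are disjoint and both start below `m`, so together they number at most
  -- `m * k`. By `inside-≥` the inside arcs use up all but `k * k` of these.
  exits-≤ : ∀ m → (∀ v → v < m → length (from v) ≤ k) →
    (∀ v → k ≤ v → v < m → k ≤ length (topped v)) → length (exits m) ≤ k * k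
  exits-≤ m few many = +-cancelˡ-≤ (length (inside m)) _ _ (begin
    length (inside m) + length (exits m)
      ≤⟨ filter-⊎-≤ (λ a → proj₁ a ⊔ proj₂ a <? m) (exit? m)
           (λ a → proj₁ a <? m) (λ a → ≤-<-trans (m≤m⊔n (proj₁ a) _)) (λ _ → proj₁)
           (λ a max<m exit → <⇒≱ (≤-<-trans (m≤n⊔m (proj₁ a) _) max<m) (proj₂ exit)) arcs ⟩
    length (fromBelow m)       ≤⟨ fromBelow-≤ m few ⟩
    m * k                      ≤⟨ inside-≥ m many ⟩
    length (inside m) + k * k  ∎)
    where open ≤-Reasoning

-- Walking along a spine

next : ∀ {t} → ℕ → (Fin (suc t) → ℕ) → Fin (suc t) → ℕ
next {zero}  e s fz     = e
next {suc t} e s fz     = s (fs fz)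
next {suc t} e s (fs i) = next e (s ∘ fs) i

next-suc : ∀ {t} e (s : Fin (suc t) → ℕ) i j → toℕ j ≡ suc (toℕ i) → next e s i ≡ s j
next-suc {suc t} e s fz     (fs fz) _  = refl
next-suc {suc t} e s (fs i) (fs j)  eq = next-suc e (s ∘ fs) i j (suc-injective eq)

next-last : ∀ {t} e (s : Fin (suc t) → ℕ) → ∃ λ i → next e s i ≡ e
next-last {zero}  e s = fz , refl
next-last {suc t} e s with i , eq ← next-last e (s ∘ fs) = fs i , eq

-- Going back from `i`, the walk stays in `C` until it reaches the start of the spine or a vertex
-- below `m`. In the second case the arc leaving that vertex enters `C`.
first-visit : ∀ {t m} {C : ℕ → Set} e (s : Fin (suc t) → ℕ) →
  (∀ i j → toℕ j ≡ suc (toℕ i) → C (s j) → s i < m ⊎ C (s i)) →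
  ∀ i → C (s i) → C (s fz) ⊎ ∃ λ j → s j < m × C (next e s j)
first-visit         e s step fz     c = inj₁ c
first-visit {suc t} {C = C} e s step (fs i) c
  with first-visit {C = C} e (s ∘ fs) (λ i j eq → step (fs i) (fs j) (cong suc eq)) i c
... | inj₂ (j , low , c′) = inj₂ (fs j , low , c′)
... | inj₁ c′ with step fz (fs fz) refl c′
...   | inj₁ low = inj₂ (fz , low , c′)
...   | inj₂ c″  = inj₁ c″

-- Arcs of a caterpillar forest over a graph

module _ {G : Graph} where

  spine : (h : CatHom G) → Fin (suc (spineLen-1 (cat h))) → ℕ
  spine h i = toℕ (hom h (inj₁ i))

  spineArc : (h : CatHom G) → Fin (suc (spineLen-1 (cat h))) → Arc
  spineArc h i = spine h i , next (n G) (spine h) i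

  legArc : (h : CatHom G) (i : Fin (suc (spineLen-1 (cat h)))) → Fin (legs (cat h) i) → Arc
  legArc h i j = toℕ (hom h (inj₂ (i , j))) , spine h i

  spineArcs legArcs arcs : CatHom G → List Arc
  spineArcs h = tabulate (spineArc h)
  legArcs h   = concat (tabulate (tabulate ∘ legArc h))
  arcs h      = spineArcs h ++ legArcs h

  forestArcs : ForestHom G → List Arc
  forestArcs = concatMap arcs

  -- Every vertex of the caterpillar yields exactly one arc, whose first label is the image of that
  -- vertex.
  from-≤-catFiber : ∀ h v → length (filter (from? (toℕ v)) (arcs h)) ≤ catFiber h v
  from-≤-catFiber h v = ≤-trans (≤-reflexive (length-filter-++ (from? (toℕ v)) (spineArcs h) _)) (+-mono-≤
    (filter-tabulate-≤ (from? (toℕ v)) (λ i → hom h (inj₁ i) Fin.≟ v) (spineArc h) (λ _ → Fin.toℕ-injective))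
    (filter-concat-tabulate-≤ (from? (toℕ v)) (tabulate ∘ legArc h) λ i →
      filter-tabulate-≤ (from? (toℕ v)) (λ j → hom h (inj₂ (i , j)) Fin.≟ v) (legArc h i) (λ _ → Fin.toℕ-injective)))

  from-≤-fiber : ∀ hs v → length (filter (from? (toℕ v)) (forestArcs hs)) ≤ fiber hs v
  from-≤-fiber []       v = z≤n
  from-≤-fiber (h ∷ hs) v = ≤-trans (≤-reflexive (length-filter-++ (from? (toℕ v)) (arcs h) _))
    (+-mono-≤ (from-≤-catFiber h v) (from-≤-fiber hs v))

  spineArc∈ : ∀ h i → spineArc h i ∈ arcs h
  spineArc∈ h i = ∈-++⁺ˡ (∈-tabulate⁺ {f = spineArc h} i)

  -- The last arc of each spine points to `n G`, so every caterpillar contributes an exit from the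
  -- whole vertex set.
  length-≤-exits : ∀ k hs → length hs ≤ length (Exits.exits k (forestArcs hs) (n G))
  length-≤-exits k []       = z≤n
  length-≤-exits k (h ∷ hs) with i , eq ← next-last (n G) (spine h) = ≤-trans
    (+-mono-≤ (filter-some (exit? (n G)) (lose (spineArc∈ h i)
                (Fin.toℕ<n (hom h (inj₁ i)) , ≤-reflexive (sym eq))))
              (length-≤-exits k hs))
    (≤-reflexive (sym (length-filter-++ (exit? (n G)) (arcs h) _)))

  stepArc∈ : ∀ h i j → toℕ j ≡ suc (toℕ i) → (spine h i , spine h j) ∈ arcs h
  stepArc∈ h i j eq = subst (λ w → (spine h i , w) ∈ arcs h) (next-suc (n G) (spine h) i j eq) (spineArc∈ h i)

  legArc∈ : ∀ h i j → legArc h i j ∈ arcs h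
  legArc∈ h i j = ∈-++⁺ʳ (spineArcs h) (∈-concat⁺′ (∈-tabulate⁺ j) (∈-tabulate⁺ {f = tabulate ∘ legArc h} i))

  arcs-cover : ∀ h x y → CatAdj (cat h) x y →
    (toℕ (hom h x) , toℕ (hom h y)) ∈ arcs h ⊎ (toℕ (hom h y) , toℕ (hom h x)) ∈ arcs h
  arcs-cover h (inj₁ i)       (inj₁ j)        (inj₁ eq) = inj₁ (stepArc∈ h i j eq)
  arcs-cover h (inj₁ i)       (inj₁ j)        (inj₂ eq) = inj₂ (stepArc∈ h j i eq)
  arcs-cover h (inj₁ i)       (inj₂ (.i , j)) refl      = inj₂ (legArc∈ h i j)
  arcs-cover h (inj₂ (i , j)) (inj₁ .i)       refl      = inj₁ (legArc∈ h i j)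

  forestArc∈ : ∀ {h hs a} → h ∈ hs → a ∈ arcs h → a ∈ forestArcs hs
  forestArc∈ h∈hs a∈ = ∈-concatMap⁺ arcs (lose h∈hs a∈)

  forestArcs-cover : ∀ {hs} → EdgeSurjective G hs → ∀ u v → adj G u v ≡ true →
    (toℕ u , toℕ v) ∈ forestArcs hs ⊎ (toℕ v , toℕ u) ∈ forestArcs hs
  forestArcs-cover surj u v uv with h , h∈hs , x , y , xy , refl , refl ← find (surj u v uv) =
    map⊎ (forestArc∈ h∈hs) (forestArc∈ h∈hs) (arcs-cover h x y xy)

  -- Two legs are never adjacent. This is what forces every cluster onto some spine.
  spine-meets : ∀ (h : CatHom G) x y → CatAdj (cat h) x y →
    ∃ λ i → hom h (inj₁ i) ≡ hom h x ⊎ hom h (inj₁ i) ≡ hom h y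
  spine-meets h (inj₁ i) y        _ = i , inj₁ refl
  spine-meets h (inj₂ _) (inj₁ i) _ = i , inj₂ refl

  BackNeighbours : ℕ → Fin (n G) → Set
  BackNeighbours k v = Σ (Fin k → Fin (n G)) λ f →
    Injective _≡_ _≡_ f × (∀ i → toℕ (f i) < toℕ v) × (∀ i → adj G (f i) v ≡ true)

  -- The edge to the back neighbour `f i` needs an arc with labels `f i` and `v`. The smaller label
  -- recovers `f i`, so distinct back neighbours need distinct arcs.
  topped-≥ : ∀ {k hs} → EdgeSurjective G hs → ∀ v → BackNeighbours k v →
    k ≤ length (Exits.topped k (forestArcs hs) (toℕ v))
  topped-≥ {k} {hs} surj v (f , f-inj , f<v , f~v) = subst (k ≤_) (length-map other (topped (toℕ v)))
    (injective-∈⇒≤ {f = toℕ ∘ f} (f-inj ∘ Fin.toℕ-injective)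
      λ i → [ below i , above i ]′ (forestArcs-cover surj (f i) v (f~v i)))
    where
    open Exits k (forestArcs hs)
    other : Arc → ℕ
    other a = proj₁ a ⊓ proj₂ a
    below : ∀ i → (toℕ (f i) , toℕ v) ∈ forestArcs hs → toℕ (f i) ∈ map other (topped (toℕ v))
    below i a∈ = subst (_∈ map other (topped (toℕ v))) (m≤n⇒m⊓n≡m (<⇒≤ (f<v i)))
      (∈-map⁺ other (∈-filter⁺ _ a∈ (m≤n⇒m⊔n≡n (<⇒≤ (f<v i)))))
    above : ∀ i → (toℕ v , toℕ (f i)) ∈ forestArcs hs → toℕ (f i) ∈ map other (topped (toℕ v))
    above i a∈ = subst (_∈ map other (topped (toℕ v))) (m≥n⇒m⊓n≡n (<⇒≤ (f<v i)))
      (∈-map⁺ other (∈-filter⁺ _ a∈ (m≥n⇒m⊔n≡m (<⇒≤ (f<v i)))))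

  -- Many clusters outside the core force a large fiber

  module _ (k m N : ℕ) (m≤n : m ≤ n G) (back : ∀ v → k ≤ toℕ v → BackNeighbours k v)
    (cluster : ℕ → ℕ)
    (closed : ∀ u v → m ≤ toℕ u → m ≤ toℕ v → adj G u v ≡ true → cluster (toℕ u) ≡ cluster (toℕ v))
    (edge : ∀ (c : Fin N) → ∃₂ λ u v → m ≤ toℕ u × m ≤ toℕ v × adj G u v ≡ true × cluster (toℕ u) ≡ toℕ c)
    where

    InCluster : ℕ → ℕ → Set
    InCluster c u = m ≤ u × cluster u ≡ c

    module _ {hs} (surj : EdgeSurjective G hs) where
      open Exits k (forestArcs hs)

      -- These are the places where a spine can come into a cluster: its first vertex and the
      -- targets of exits from the core. Leg arcs and final arcs among the exits only lengthen the
      -- list.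
      entries : List ℕ
      entries = map (λ h → spine h fz) hs ++ map proj₂ (exits m)

      cluster-on-spine : ∀ (c : Fin N) → ∃ λ h → h ∈ hs × ∃ λ i → InCluster (toℕ c) (spine h i)
      cluster-on-spine c with u , v , m≤u , m≤v , uv , eq ← edge c
        with h , h∈hs , x , y , xy , refl , refl ← find (surj u v uv)
        with spine-meets h x y xy
      ... | i , inj₁ p = h , h∈hs , i , subst (InCluster (toℕ c) ∘ toℕ) (sym p) (m≤u , eq)
      ... | i , inj₂ p = h , h∈hs , i , subst (InCluster (toℕ c) ∘ toℕ) (sym p)
                           (m≤v , trans (sym (closed u v m≤u m≤v uv)) eq)

      cluster-entered : ∀ (c : Fin N) → ∃ λ u → u ∈ entries × cluster u ≡ toℕ c
      cluster-entered c with h , h∈hs , i , on ← cluster-on-spine c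
        with first-visit {m = m} {C = InCluster (toℕ c)} (n G) (spine h) step i on
        where
        step : ∀ i j → toℕ j ≡ suc (toℕ i) → InCluster (toℕ c) (spine h j) →
          spine h i < m ⊎ InCluster (toℕ c) (spine h i)
        step i j eq (m≤sj , clj) with spine h i <? m
        ... | yes low = inj₁ low
        -- Both ends of this spine edge lie outside the core, so `closed` puts them in the same
        -- cluster.
        ... | no ¬low = inj₂ (≮⇒≥ ¬low ,
          trans (closed _ _ (≮⇒≥ ¬low) m≤sj (pres h (inj₁ i) (inj₁ j) (inj₁ eq))) clj)
      ... | inj₁ (_ , eq) = _ , ∈-++⁺ˡ (∈-map⁺ _ h∈hs) , eq
      ... | inj₂ (j , low , m≤w , eq) = _ , ∈-++⁺ʳ _ (∈-map⁺ proj₂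
              (∈-filter⁺ _ (forestArc∈ h∈hs (spineArc∈ h j)) (low , m≤w))) , eq

      -- An entry has only one cluster label, so `N` clusters need `N` entries.
      N≤entries : N ≤ length entries
      N≤entries = subst (N ≤_) (length-map cluster entries)
        (injective-∈⇒≤ Fin.toℕ-injective λ c →
          let _ , u∈ , eq = cluster-entered c in subst (_∈ map cluster entries) eq (∈-map⁺ cluster u∈))

      entries-≤ : (∀ v → fiber hs v ≤ k) → length entries ≤ k * k + k * k
      entries-≤ fiber≤k = begin
        length entries                                        ≡⟨ length-++ (map (λ h → spine h fz) hs) ⟩
        length (map (λ h → spine h fz) hs) + length (map proj₂ (exits m))
          ≡⟨ cong₂ _+_ (length-map _ hs) (length-map proj₂ (exits m)) ⟩
        length hs + length (exits m)
          -- The bound on exits is used twice: for the whole vertex set, where it limits the number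
          -- of caterpillars, and for the core.
          ≤⟨ +-mono-≤ (≤-trans (length-≤-exits k hs) (exits-≤k² ≤-refl)) (exits-≤k² m≤n) ⟩
        k * k + k * k ∎
        where
        open ≤-Reasoning
        few : ∀ v → v < n G → length (from v) ≤ k
        few v v<n = subst (λ w → length (from w) ≤ k) (Fin.toℕ-fromℕ< v<n)
          (≤-trans (from-≤-fiber hs (fromℕ< v<n)) (fiber≤k _))
        many : ∀ v → k ≤ v → v < n G → k ≤ length (topped v)
        many v k≤v v<n = subst (λ w → k ≤ length (topped w)) (Fin.toℕ-fromℕ< v<n)
          (topped-≥ {k} {hs} surj (fromℕ< v<n) (back _ (subst (k ≤_) (sym (Fin.toℕ-fromℕ< v<n)) k≤v)))
        exits-≤k² : ∀ {l} → l ≤ n G → length (exits l) ≤ k * k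
        exits-≤k² {l} l≤n = exits-≤ l (λ v v<l → few v (<-≤-trans v<l l≤n))
          (λ v k≤v v<l → many v k≤v (<-≤-trans v<l l≤n))

    clusters⇒CafGe : k * k + k * k < N → CafGe G (suc k)
    clusters⇒CafGe 2k²<N hs surj with Fin.any? (λ v → suc k ≤? fiber hs v)
    ... | yes large = large
    ... | no ¬large = contradiction
      (≤-trans (N≤entries surj) (entries-≤ surj λ v → ≮⇒≥ λ k<v → ¬large (v , k<v))) (<⇒≱ 2k²<N)

-- The graph: core, inner and outer vertices

module Construction (k₀ N : ℕ) (0<N : 0 < N) where

  -- With `N + k` core vertices, the labels from `a` to `a + k` lie in the core for every `a < N`.
  -- The other two blocks hold the `N` inner and the `N` outer vertices.
  k m order : ℕ
  k     = suc (suc k₀)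
  m     = N + k
  order = m + N + N

  -- A core vertex v ≥ k is attached to v - k … v - 1. The vertex m + a is attached
  -- to a, a + 2 … a + k; this clique is no interval because k ≥ 2, so the core does
  -- not use it. The vertex m + N + a is attached to m + a, a + 2 … a + k.
  data Kind (v : ℕ) : Set where
    core  : v < m → Kind v
    inner : ∀ a → v ≡ m + a → a < N → Kind v
    outer : ∀ a → v ≡ m + N + a → Kind v

  kind : ∀ v → Kind v
  kind v with v <? m
  ... | yes v<m = core v<m
  ... | no  v≮m with v <? m + N
  ...   | yes v<m+N = inner (v ∸ m) (sym (m+[n∸m]≡n (≮⇒≥ v≮m)))
                        (+-cancelˡ-< m _ _ (subst (_< m + N) (sym (m+[n∸m]≡n (≮⇒≥ v≮m))) v<m+N))
  ...   | no  v≮m+N = outer (v ∸ (m + N)) (sym (m+[n∸m]≡n (≮⇒≥ v≮m+N)))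

  -- A back-neighbourhood is the anchor together with the `k - 1` labels strictly between `base` and
  -- `base + k`. In the core anchor and base coincide, which for `k ≤ v` gives the interval from
  -- `v - k` to `v - 1`.
  anchor base : ∀ {v} → Kind v → ℕ
  anchor {v} (core _)      = v ∸ k
  anchor     (inner a _ _) = a
  anchor     (outer a _)   = m + a
  base {v} (core _)      = v ∸ k
  base     (inner a _ _) = suc a
  base     (outer a _)   = suc a

  Between : ℕ → ℕ → Set
  Between b u = b < u × u < b + k

  Back : ∀ {v} → Kind v → ℕ → Set
  Back κ u = u ≡ anchor κ ⊎ Between (base κ) u

  infix 4 _◁_ _◁?_

  -- For core v < k truncated subtraction makes v ∸ k = 0, so every u < v satisfies u ◁ v.
  _◁_ : ℕ → ℕ → Set
  u ◁ v = u < v × Back (kind v) u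

  _◁?_ : ∀ u v → Dec (u ◁ v)
  u ◁? v = (u <? v) ×-dec ((u ≟ anchor (kind v)) ⊎-dec ((base (kind v) <? u) ×-dec (u <? base (kind v) + k)))

  -- These are the adjacencies of the `k`-th power of a path; all cliques inside the core rest on
  -- them.
  near⇒◁ : ∀ {u v} → u < v → v < m → v ≤ u + k → u ◁ v
  near⇒◁ {u} {v} u<v v<m v≤u+k with kind v
  ... | inner a refl _ = contradiction v<m (m+n≮m m a)
  ... | outer a refl   = contradiction v<m (≤⇒≯ (≤-trans (m≤m+n m N) (m≤m+n (m + N) a)))
  ... | core _ with u ≟ v ∸ k
  ...   | yes u≡ = u<v , inj₁ u≡
  ...   | no  u≢ = u<v , inj₂ (≤∧≢⇒< (m≤n+o⇒m∸n≤o v k (subst (v ≤_) (+-comm u k) v≤u+k)) (u≢ ∘ sym) ,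
                     <-≤-trans u<v (subst (v ≤_) (+-comm k _) (m≤n+m∸n v k)))

  -- The ranges of the three kinds are disjoint, and cancelling `m` identifies the index. The bound
  -- is existential because `kind` builds its own proof of `a < N`.
  kind-inner : ∀ {a} → a < N → ∃ λ lt → kind (m + a) ≡ inner a refl lt
  kind-inner {a} a<N with kind (m + a)
  ... | core lt = contradiction lt (m+n≮m m a)
  ... | outer b eq = contradiction a<N (≤⇒≯ (≤-trans (m≤m+n N b)
                       (≤-reflexive (sym (+-cancelˡ-≡ m _ _ (trans eq (+-assoc m N b)))))))
  ... | inner b eq lt with refl ← +-cancelˡ-≡ m a b eq | refl ← eq = lt , refl

  inner-back : ∀ {a u} → a < N → u < m → u ≡ a ⊎ Between (suc a) u → u ◁ m + a
  inner-back {a} a<N u<m back rewrite proj₂ (kind-inner a<N) = <-≤-trans u<m (m≤m+n m a) , back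

  outer-back : ∀ {a u} → u < m + N + a → u ≡ m + a ⊎ Between (suc a) u → u ◁ m + N + a
  outer-back {a} u< back with kind (m + N + a)
  ... | core lt = contradiction lt (≤⇒≯ (≤-trans (m≤m+n m N) (m≤m+n (m + N) a)))
  ... | inner b eq b<N = contradiction b<N (≤⇒≯ (≤-trans (m≤m+n N a)
                       (≤-reflexive (+-cancelˡ-≡ m _ _ (trans (sym (+-assoc m N a)) eq)))))
  ... | outer b eq with refl ← +-cancelˡ-≡ (m + N) a b eq = u< , back

  -- Back-neighbourhoods are cliques of earlier vertices

  outer-index<N : ∀ {a} → m + N + a < order → a < N
  outer-index<N {a} = +-cancelˡ-< (m + N) a N

  -- The interval lies in the core and so is a clique; the anchor is one more vertex, adjacent to
  -- the whole interval. Together this gives a `k`-clique of vertices before `v`.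
  record Placement (v : ℕ) (κ : Kind v) : Set where
    field
      anchor<v      : anchor κ < v
      base+k≤m      : base κ + k ≤ m
      base+k≤v      : base κ + k ≤ v
      anchor∉       : ¬ Between (base κ) (anchor κ)
      anchor-clique : ∀ {u} → Between (base κ) u → anchor κ ◁ u ⊎ u ◁ anchor κ

  placement : ∀ v → v < order → k ≤ v → (κ : Kind v) → Placement v κ
  placement v _ k≤v (core v<m) = record
    { anchor<v      = ∸-monoʳ-< {v} {k} {0} (s≤s z≤n) k≤v
    ; base+k≤m      = ≤-trans (≤-reflexive (m∸n+n≡m k≤v)) (<⇒≤ v<m)
    ; base+k≤v      = ≤-reflexive (m∸n+n≡m k≤v)
    ; anchor∉       = λ (lt , _) → <-irrefl refl lt
    ; anchor-clique = λ (lt , lt′) → inj₁ (near⇒◁ lt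
        (<-trans (<-≤-trans lt′ (≤-reflexive (m∸n+n≡m k≤v))) v<m) (<⇒≤ lt′))
    }
  placement v _ _ (inner a refl a<N) = record
    { anchor<v      = <-≤-trans a<N (≤-trans (m≤m+n N k) (m≤m+n m a))
    ; base+k≤m      = +-monoˡ-≤ k a<N
    ; base+k≤v      = ≤-trans (+-monoˡ-≤ k a<N) (m≤m+n m a)
    ; anchor∉       = λ (lt , _) → <-asym lt ≤-refl
    ; anchor-clique = λ (lt , lt′) → inj₁ (near⇒◁ (<⇒≤ lt) (<-≤-trans lt′ (+-monoˡ-≤ k a<N)) (s≤s⁻¹ lt′))
    }
  placement v v<order _ (outer a refl) = record
    { anchor<v      = subst (m + a <_) (sym (+-assoc m N a)) (+-monoʳ-< m (+-monoˡ-< a 0<N))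
    ; base+k≤m      = +-monoˡ-≤ k a<N
    ; base+k≤v      = ≤-trans (+-monoˡ-≤ k a<N) (≤-trans (m≤m+n m N) (m≤m+n (m + N) a))
    ; anchor∉       = λ (_ , lt) → m+n≮m m a (<-≤-trans lt (+-monoˡ-≤ k a<N))
    -- The anchor `m + a` is itself attached to this interval, so here the anchor is the later
    -- vertex.
    ; anchor-clique = λ b → inj₂ (inner-back a<N (<-≤-trans (proj₂ b) (+-monoˡ-≤ k a<N)) (inj₂ b))
    }
    where
    a<N : a < N
    a<N = outer-index<N v<order

  Between-clique : ∀ {b u u′} → b + k ≤ m → Between b u → Between b u′ → u < u′ → u ◁ u′
  Between-clique b+k≤m (b<u , _) (_ , u′<b+k) u<u′ =
    near⇒◁ u<u′ (<-≤-trans u′<b+k b+k≤m) (≤-trans (<⇒≤ u′<b+k) (+-monoˡ-≤ k (<⇒≤ b<u)))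

  G : Graph
  G = record
    { n      = order
    ; adj    = λ u v → ⌊ toℕ u ◁? toℕ v ⌋ ∨ ⌊ toℕ v ◁? toℕ u ⌋
    ; sym    = λ u v → ∨-comm ⌊ toℕ u ◁? toℕ v ⌋ _
    ; irrefl = λ v → irrefl′ (toℕ v)
    }
    where
    irrefl′ : ∀ v → ⌊ v ◁? v ⌋ ∨ ⌊ v ◁? v ⌋ ≡ false
    irrefl′ v with v ◁? v
    ... | yes (v<v , _) = contradiction v<v (<-irrefl refl)
    ... | no _ = refl

  ◁⇒adj : ∀ u v → toℕ u ◁ toℕ v ⊎ toℕ v ◁ toℕ u → adj G u v ≡ true
  ◁⇒adj u v u~v with toℕ u ◁? toℕ v | toℕ v ◁? toℕ u
  ... | yes _ | _     = refl
  ... | no _  | yes _ = refl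
  ... | no ¬p | no ¬q = contradiction u~v [ ¬p , ¬q ]′

  adj⇒◁ : ∀ u v → adj G u v ≡ true → toℕ u ◁ toℕ v ⊎ toℕ v ◁ toℕ u
  adj⇒◁ u v eq with toℕ u ◁? toℕ v | toℕ v ◁? toℕ u
  ... | yes p | _     = inj₁ p
  ... | no _  | yes q = inj₂ q
  adj⇒◁ u v () | no _ | no _

  adj∧<⇒◁ : ∀ u v → toℕ u < toℕ v → adj G u v ≡ true → toℕ u ◁ toℕ v
  adj∧<⇒◁ u v u<v uv with adj⇒◁ u v uv
  ... | inj₁ p         = p
  ... | inj₂ (v<u , _) = contradiction v<u (<-asym u<v)

  module _ (v : Fin order) (k≤v : k ≤ toℕ v) where
    open Placement (placement (toℕ v) (Fin.toℕ<n v) k≤v (kind (toℕ v)))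

    private
      b : ℕ
      b = base (kind (toℕ v))

    backℕ : Fin k → ℕ
    backℕ fz     = anchor (kind (toℕ v))
    backℕ (fs i) = suc b + toℕ i

    between : ∀ i → Between b (backℕ (fs i))
    between i = s≤s (m≤m+n b (toℕ i)) ,
      subst (suc b + toℕ i <_) (sym (+-suc b (suc k₀))) (s≤s (+-monoʳ-< b (Fin.toℕ<n i)))

    backℕ-◁ : ∀ i → backℕ i ◁ toℕ v
    backℕ-◁ fz     = anchor<v , inj₁ refl
    backℕ-◁ (fs i) = <-≤-trans (proj₂ (between i)) base+k≤v , inj₂ (between i)

    backℕ-injective : ∀ i j → backℕ i ≡ backℕ j → i ≡ j
    backℕ-injective fz     fz     _  = refl
    backℕ-injective fz     (fs j) eq = contradiction (subst (Between b) (sym eq) (between j)) anchor∉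
    backℕ-injective (fs i) fz     eq = contradiction (subst (Between b) eq (between i)) anchor∉
    backℕ-injective (fs i) (fs j) eq = cong fs (Fin.toℕ-injective (+-cancelˡ-≡ (suc b) _ _ eq))

    backℕ-clique : ∀ i j → i ≢ j → backℕ i ◁ backℕ j ⊎ backℕ j ◁ backℕ i
    backℕ-clique fz     fz     i≢j = contradiction refl i≢j
    backℕ-clique fz     (fs j) _   = anchor-clique (between j)
    backℕ-clique (fs i) fz     _   = swap (anchor-clique (between i))
    backℕ-clique (fs i) (fs j) i≢j with <-cmp (backℕ (fs i)) (backℕ (fs j))
    ... | tri< lt _ _ = inj₁ (Between-clique base+k≤m (between i) (between j) lt)
    ... | tri≈ _ eq _ = contradiction (backℕ-injective (fs i) (fs j) eq) i≢j
    ... | tri> _ _ gt = inj₂ (Between-clique base+k≤m (between j) (between i) gt)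

    backℕ-surjective : ∀ u → u ◁ toℕ v → ∃ λ i → backℕ i ≡ u
    backℕ-surjective u (_ , inj₁ u≡)           = fz , sym u≡
    backℕ-surjective u (_ , inj₂ (b<u , u<b+k)) = fs (fromℕ< u∸<) ,
      trans (cong (suc b +_) (Fin.toℕ-fromℕ< u∸<)) (m+[n∸m]≡n b<u)
      where
      u∸< : u ∸ suc b < suc k₀
      u∸< = +-cancelˡ-< (suc b) _ _ (subst₂ _<_ (sym (m+[n∸m]≡n b<u)) (+-suc b (suc k₀)) u<b+k)

    back< : ∀ i → backℕ i < order
    back< i = <-trans (proj₁ (backℕ-◁ i)) (Fin.toℕ<n v)

    back : Fin k → Fin order
    back i = fromℕ< (back< i)

    toℕ-back : ∀ i → toℕ (back i) ≡ backℕ i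
    toℕ-back i = Fin.toℕ-fromℕ< (back< i)

    back-◁ : ∀ i → toℕ (back i) ◁ toℕ v
    back-◁ i = subst (_◁ toℕ v) (sym (toℕ-back i)) (backℕ-◁ i)

    back-injective : Injective _≡_ _≡_ back
    back-injective {i} {j} eq = backℕ-injective i j
      (trans (sym (toℕ-back i)) (trans (cong toℕ eq) (toℕ-back j)))

    back-clique : ∀ i j → i ≢ j → adj G (back i) (back j) ≡ true
    back-clique i j i≢j = ◁⇒adj (back i) (back j) (subst₂ (λ x y → x ◁ y ⊎ y ◁ x)
      (sym (toℕ-back i)) (sym (toℕ-back j)) (backℕ-clique i j i≢j))

    back-surjective : ∀ u → toℕ u ◁ toℕ v → ∃ λ i → back i ≡ u
    back-surjective u u◁v with i , eq ← backℕ-surjective (toℕ u) u◁v =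
      i , Fin.toℕ-injective (trans (toℕ-back i) eq)

  -- Distinctness of back-neighbourhoods

  _⊑_ : ∀ {v w} → Kind v → Kind w → Set
  _⊑_ {v} {w} κ λ′ = ∀ u → u < v × Back κ u → u < w × Back λ′ u

  -- Here and in the next two lemmas an inclusion is tested at the anchor: the least back neighbour
  -- of a core or inner vertex, and the only one outside the core for an outer vertex.
  core⊑ : ∀ {v w} (v<m : v < m) (λ′ : Kind w) → k ≤ v → core v<m ⊑ λ′ → Back λ′ (v ∸ k)
  core⊑ {v} v<m λ′ k≤v sub = proj₂ (sub (v ∸ k) (∸-monoʳ-< {v} {k} {0} (s≤s z≤n) k≤v , inj₁ refl))

  inner⊑ : ∀ {a w} a<N (λ′ : Kind w) → inner a refl a<N ⊑ λ′ → Back λ′ a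
  inner⊑ {a} a<N λ′ sub = proj₂ (sub a (<-≤-trans a<N (≤-trans (m≤m+n N k) (m≤m+n m a)) , inj₁ refl))

  outer⊑ : ∀ {a w} (λ′ : Kind w) → outer a refl ⊑ λ′ → m + a < w × Back λ′ (m + a)
  outer⊑ {a} λ′ sub = sub (m + a) (subst (m + a <_) (sym (+-assoc m N a)) (+-monoʳ-< m (+-monoˡ-< a 0<N)) , inj₁ refl)

  core-min : ∀ {v u} (v<m : v < m) → Back (core v<m) u → v ∸ k ≤ u
  core-min v<m (inj₁ refl)     = ≤-refl
  core-min v<m (inj₂ (lt , _)) = <⇒≤ lt

  inner-min : ∀ {v a u eq} a<N → Back {v} (inner a eq a<N) u → a ≤ u
  inner-min a<N (inj₁ refl)     = ≤-refl
  inner-min a<N (inj₂ (lt , _)) = <⇒≤ (<⇒≤ lt)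

  inner-bound : ∀ {v a u eq} a<N → Back {v} (inner a eq a<N) u → u < m
  inner-bound a<N (inj₁ refl)     = <-≤-trans a<N (m≤m+n N k)
  inner-bound a<N (inj₂ (_ , lt)) = <-≤-trans lt (+-monoˡ-≤ k a<N)

  -- Two inclusions would make the least elements agree, so `a` would be `v ∸ k`. But `suc (v ∸ k)`,
  -- which is below `v` since `k` is at least 2, lies in the interval of the core vertex and in the
  -- gap of the inner one.
  core⋢inner : ∀ {v a} (v<m : v < m) (a<N : a < N) → k ≤ v →
    core v<m ⊑ inner a refl a<N → ¬ (inner a refl a<N ⊑ core v<m)
  core⋢inner {v} {a} v<m a<N k≤v sub sup
    with refl ← ≤-antisym (core-min v<m (inner⊑ a<N (core v<m) sup))
                          (inner-min {eq = refl} a<N (core⊑ v<m (inner a refl a<N) k≤v sub))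
    with sub (suc (v ∸ k)) (lt , inj₂ (≤-refl , lt′))
    where
    lt′ : suc (v ∸ k) < v ∸ k + k
    lt′ = ≤-trans (≤-reflexive (+-comm 2 _)) (+-monoʳ-≤ (v ∸ k) (s≤s (s≤s z≤n)))
    lt : suc (v ∸ k) < v
    lt = <-≤-trans lt′ (≤-reflexive (m∸n+n≡m k≤v))
  ... | _ , inj₁ eq       = 1+n≢n eq
  ... | _ , inj₂ (gt , _) = <-irrefl refl gt

  outer⋢core : ∀ {a w} (w<m : w < m) → ¬ (outer a refl ⊑ core w<m)
  outer⋢core {a} w<m sub = m+n≮m m a (<-trans (proj₁ (outer⊑ (core w<m) sub)) w<m)

  outer⋢inner : ∀ {a b} (b<N : b < N) → ¬ (outer a refl ⊑ inner b refl b<N)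
  outer⋢inner {a} b<N sub = m+n≮m m a (inner-bound {eq = refl} b<N (proj₂ (outer⊑ (inner _ refl b<N) sub)))

  -- Among core vertices, and among inner vertices, the least back neighbour determines the vertex.
  -- Only outer vertices have a back neighbour outside the core, namely `m + a`, and it determines
  -- `a`.
  ⊑-antisym : ∀ {v w} (κ : Kind v) (λ′ : Kind w) → v < order → w < order → k ≤ v → k ≤ w →
    κ ⊑ λ′ → λ′ ⊑ κ → v ≡ w
  ⊑-antisym (core v<m) (core w<m) _ _ k≤v k≤w sub sup = ∸-cancelʳ-≡ k≤v k≤w
    (≤-antisym (core-min v<m (core⊑ w<m (core v<m) k≤w sup)) (core-min w<m (core⊑ v<m (core w<m) k≤v sub)))
  ⊑-antisym (core v<m) (inner b refl b<N) _ _ k≤v _ sub sup = contradiction sup (core⋢inner v<m b<N k≤v sub)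
  ⊑-antisym (inner a refl a<N) (core w<m) _ _ _ k≤w sub sup = contradiction sub (core⋢inner w<m a<N k≤w sup)
  ⊑-antisym (inner a refl a<N) (inner b refl b<N) _ _ _ _ sub sup = cong (m +_)
    (≤-antisym (inner-min {eq = refl} a<N (inner⊑ b<N (inner a refl a<N) sup))
               (inner-min {eq = refl} b<N (inner⊑ a<N (inner b refl b<N) sub)))
  ⊑-antisym (core v<m) (outer b refl) _ _ _ _ _ sup = contradiction sup (outer⋢core v<m)
  ⊑-antisym (inner a refl a<N) (outer b refl) _ _ _ _ _ sup = contradiction sup (outer⋢inner a<N)
  ⊑-antisym (outer a refl) (core w<m) _ _ _ _ sub _ = contradiction sub (outer⋢core w<m)
  ⊑-antisym (outer a refl) (inner b refl b<N) _ _ _ _ sub _ = contradiction sub (outer⋢inner b<N)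
  ⊑-antisym (outer a refl) (outer b refl) _ w<order _ _ sub _ with proj₂ (outer⊑ (outer b refl) sub)
  ... | inj₁ eq       = cong (m + N +_) (+-cancelˡ-≡ m a b eq)
  ... | inj₂ (_ , lt) = contradiction (<-≤-trans lt (+-monoˡ-≤ k (outer-index<N w<order))) (m+n≮m m a)

  -- The graph is a simple `k`-tree

  isSimpleKTree : IsSimpleKTree k G
  isSimpleKTree = ≤-trans 1+k≤m (≤-trans (m≤m+n m N) (m≤m+n (m + N) N)) , initial-clique , attached , distinct
    where
    1+k≤m : suc k ≤ m
    1+k≤m = +-monoˡ-≤ k 0<N

    initial : ∀ {u v} → v < suc k → u < v → u ◁ v
    initial {u} v≤k u<v = near⇒◁ u<v (≤-trans v≤k 1+k≤m) (≤-trans (s≤s⁻¹ v≤k) (m≤n+m k u))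

    initial-clique : ∀ (u v : Fin order) → toℕ u < suc k → toℕ v < suc k → u ≢ v → adj G u v ≡ true
    initial-clique u v u≤k v≤k u≢v with <-cmp (toℕ u) (toℕ v)
    ... | tri< lt _ _ = ◁⇒adj u v (inj₁ (initial v≤k lt))
    ... | tri≈ _ eq _ = contradiction (Fin.toℕ-injective eq) u≢v
    ... | tri> _ _ gt = ◁⇒adj u v (inj₂ (initial u≤k gt))

    attached : ∀ (v : Fin order) → suc k ≤ toℕ v → Σ (Fin k → Fin order) λ f →
      Injective _≡_ _≡_ f × (∀ i → toℕ (f i) < toℕ v) ×
      (∀ i j → i ≢ j → adj G (f i) (f j) ≡ true) ×
      (∀ u → toℕ u < toℕ v → (adj G u v ≡ true ⇔ ∃ λ i → f i ≡ u))
    attached v k<v = back v k≤v , back-injective v k≤v , proj₁ ∘ back-◁ v k≤v , back-clique v k≤v ,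
      λ u u<v → mk⇔ (back-surjective v k≤v u ∘ adj∧<⇒◁ u v u<v)
        λ { (i , refl) → ◁⇒adj (back v k≤v i) v (inj₁ (back-◁ v k≤v i)) }
      where
      k≤v : k ≤ toℕ v
      k≤v = <⇒≤ k<v

    distinct : ∀ (v w : Fin order) → suc k ≤ toℕ v → suc k ≤ toℕ w → v ≢ w →
      ¬ (∀ u → ((toℕ u < toℕ v × adj G u v ≡ true) ⇔ (toℕ u < toℕ w × adj G u w ≡ true)))
    distinct v w k<v k<w v≢w same = v≢w (Fin.toℕ-injective
      (⊑-antisym (kind (toℕ v)) (kind (toℕ w)) (Fin.toℕ<n v) (Fin.toℕ<n w) (<⇒≤ k<v) (<⇒≤ k<w)
        (transport v w (Equivalence.to ∘ same)) (transport w v (Equivalence.from ∘ same))))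
      where
      -- `same` speaks of vertices and `_⊑_` of numbers, so `u` is first turned into a vertex by way
      -- of `u < v < order`.
      transport : ∀ v w → (∀ u → toℕ u < toℕ v × adj G u v ≡ true → toℕ u < toℕ w × adj G u w ≡ true) →
        ∀ u → u ◁ toℕ v → u ◁ toℕ w
      transport v w imp u u◁v = subst (_◁ toℕ w) eq (adj∧<⇒◁ u′ w (proj₁ image) (proj₂ image))
        where
        u<order : u < order
        u<order = <-trans (proj₁ u◁v) (Fin.toℕ<n v)
        u′ : Fin order
        u′ = fromℕ< u<order
        eq : toℕ u′ ≡ u
        eq = Fin.toℕ-fromℕ< u<order
        u′◁v : toℕ u′ ◁ toℕ v
        u′◁v = subst (_◁ toℕ v) (sym eq) u◁v
        image = imp u′ (proj₁ u′◁v , ◁⇒adj u′ v (inj₁ u′◁v))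

  -- Clusters of the graph and the lower bound

  cluster : ℕ → ℕ
  cluster v with kind v
  -- A default value: only labels from `m` on count as members of clusters.
  ... | core _      = 0
  ... | inner a _ _ = a
  ... | outer a _   = a

  cluster-inner : ∀ {a} → a < N → cluster (m + a) ≡ a
  cluster-inner a<N rewrite proj₂ (kind-inner a<N) = refl

  -- The only back neighbour outside the core that any vertex has is the anchor `m + a` of an outer
  -- vertex, and these two form cluster `a`.
  cluster-closed : ∀ {u v} → v < order → m ≤ u → u ◁ v → cluster u ≡ cluster v
  cluster-closed {u} {v} v<order m≤u (u<v , back) with kind v
  ... | core v<m = contradiction (<-trans u<v v<m) (≤⇒≯ m≤u)
  ... | inner a refl a<N = contradiction (inner-bound {eq = refl} a<N back) (≤⇒≯ m≤u)
  ... | outer a refl with back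
  ...   | inj₁ refl     = cluster-inner (outer-index<N v<order)
  ...   | inj₂ (_ , lt) = contradiction (<-≤-trans lt (+-monoˡ-≤ k (outer-index<N v<order))) (≤⇒≯ m≤u)

  cafGe : k * k + k * k < N → CafGe G (suc k)
  cafGe = clusters⇒CafGe k m N (≤-trans (m≤m+n m N) (m≤m+n (m + N) N)) backNeighbours cluster closed edge
    where
    backNeighbours : ∀ v → k ≤ toℕ v → BackNeighbours {G} k v
    backNeighbours v k≤v = back v k≤v , back-injective v k≤v , proj₁ ∘ back-◁ v k≤v ,
      λ i → ◁⇒adj (back v k≤v i) v (inj₁ (back-◁ v k≤v i))

    closed : ∀ u v → m ≤ toℕ u → m ≤ toℕ v → adj G u v ≡ true → cluster (toℕ u) ≡ cluster (toℕ v)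
    closed u v m≤u m≤v uv with adj⇒◁ u v uv
    ... | inj₁ u◁v = cluster-closed (Fin.toℕ<n v) m≤u u◁v
    ... | inj₂ v◁u = sym (cluster-closed (Fin.toℕ<n u) m≤v v◁u)

    edge : ∀ (c : Fin N) → ∃₂ λ u v →
      m ≤ toℕ u × m ≤ toℕ v × adj G u v ≡ true × cluster (toℕ u) ≡ toℕ c
    -- The edge joins the outer vertex of the cluster to its anchor.
    edge c = u , v , subst (m ≤_) (sym u≡) (m≤m+n m a) ,
      subst (m ≤_) (sym v≡) (≤-trans (m≤m+n m N) (m≤m+n (m + N) a)) ,
      ◁⇒adj u v (inj₁ (subst₂ _◁_ (sym u≡) (sym v≡) (outer-back w<x (inj₁ refl)))) ,
      trans (cong cluster u≡) (cluster-inner a<N)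
      where
      a = toℕ c
      a<N : a < N
      a<N = Fin.toℕ<n c
      w<x : m + a < m + N + a
      w<x = +-monoˡ-< a (subst (_< m + N) (+-identityʳ m) (+-monoʳ-< m 0<N))
      x<order : m + N + a < order
      x<order = +-monoʳ-< (m + N) a<N
      u v : Fin order
      u = fromℕ< (<-trans w<x x<order)
      v = fromℕ< x<order
      u≡ : toℕ u ≡ m + a
      u≡ = Fin.toℕ-fromℕ< (<-trans w<x x<order)
      v≡ : toℕ v ≡ m + N + a
      v≡ = Fin.toℕ-fromℕ< x<order

theorem17 : ∀ (k : ℕ) → 2 ≤ k → ∃ λ (G : Graph) → StwLe G k × CafGe G (suc k)
theorem17 (suc zero) (s≤s ())
theorem17 k@(suc (suc k₀)) _ =
  -- `G` is itself a simple `k`-tree, embedded by the identity. It is built with `2 k² + 1`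
  -- clusters, the least number that `cafGe` admits.
  G , (k , ≤-refl , G , isSimpleKTree , id , id , λ _ _ → id) , cafGe ≤-refl
  where open Construction k₀ (suc (k * k + k * k)) (s≤s z≤n) hiding (k)
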